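{- For all $n\ge0$, $$\prod_{i=1}^n(1+q^i)=F_{n+1}(q)+\sum_{k=0}^{n-2}q^kF_k(q)\prod_{i=k+3}^n(1+q^i),$$ where an empty product equals $1$.
   Context: $\Pi_n(13/2,123)$ is the set of layered matchings of $[n]$: set partitions whose blocks are consecutive intervals $[1,i_1]/\dots/[i_{k-1}+1,n]$, each of size $1$ or $2$. $\Pi_0(13/2,123)$ consists of the empty partition. For $\pi=B_1/\dots/B_k$ with $\min B_1<\dots<\min B_k$, $rb(\pi)$ is the number of pairs $(b,B_j)$ with $b\in B_i$, $j>i$, $\max B_j>b$. Define $F_n(q)=\sum_{\pi\in\Pi_n(13/2,123)}q^{rb(\pi)}$, so $F_0(q)=F_1(q)=1$. -}

module Defs where

open import Data.List using (List; []; _∷_; _++_; _∷ʳ_; [_]; map; foldr; filter; concatMap; length; replicate; applyUpTo; cartesianProduct)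
open import Data.List.Extrema.Nat using (max)
open import Data.List.Relation.Unary.All using (All; all?)
open import Data.List.Relation.Unary.Linked using (Linked; linked?)
open import Data.Nat using (ℕ; zero; suc; _+_; _*_; _∸_; _<?_; _≟_)
open import Data.Product using (_×_; _,_)
open import Data.Sum using (_⊎_)
open import Relation.Binary.PropositionalEquality using (_≡_)
open import Relation.Nullary using (Dec; _×-dec_; _⊎-dec_)

-- Polynomials in ℕ[q] as coefficient lists, constant term first.  Trailing
-- zeros are allowed, so equality of polynomials is _≈_ rather than _≡_.

Poly : Set
Poly = List ℕ

coeff : Poly → ℕ → ℕ
coeff []      _       = 0
coeff (a ∷ _) zero    = a
coeff (_ ∷ p) (suc i) = coeff p i

infix 4 _≈_
_≈_ : Poly → Poly → Set
p ≈ r = ∀ i → coeff p i ≡ coeff r i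

0ₚ 1ₚ : Poly
0ₚ = []
1ₚ = [ 1 ]

infix 9 q^_
q^_ : ℕ → Poly
q^ k = replicate k 0 ++ [ 1 ]

infixl 6 _⊕_
_⊕_ : Poly → Poly → Poly
[]      ⊕ r       = r
(a ∷ p) ⊕ []      = a ∷ p
(a ∷ p) ⊕ (b ∷ r) = (a + b) ∷ (p ⊕ r)

infixl 7 _⊗_
_⊗_ : Poly → Poly → Poly
[]      ⊗ r = 0ₚ
(a ∷ p) ⊗ r = map (a *_) r ⊕ (0 ∷ (p ⊗ r))

sumOver prodOver : {A : Set} → List A → (A → Poly) → Poly
sumOver  xs f = foldr (λ x p → f x ⊕ p) 0ₚ xs
prodOver xs f = foldr (λ x p → f x ⊗ p) 1ₚ xs

infix 5 sumOver prodOver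
syntax sumOver  xs (λ x → e) = ∑[ x ∈ xs ] e
syntax prodOver xs (λ x → e) = ∏[ x ∈ xs ] e

-- The integers a, a + 1, …, b; empty when b < a.
range : ℕ → ℕ → List ℕ
range a b = applyUpTo (a +_) (suc b ∸ a)

-- A set partition of {1, …, n} is written in its canonical form B₁/…/Bₖ: each
-- block lists its elements in increasing order, and min B₁ < … < min Bₖ.

Block Partition : Set
Block     = List ℕ
Partition = List Block

-- All ways of adding an element m, larger than all those present, to a
-- partition: to one of the blocks, or as a new (hence last) block.
insertions : ℕ → Partition → List Partition
insertions m []      = [ [ [ m ] ] ]
insertions m (B ∷ π) = ((B ∷ʳ m) ∷ π) ∷ map (B ∷_) (insertions m π)

-- Each set partition of {1, …, n} exactly once.
setPartitions : ℕ → List Partition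
setPartitions zero    = [ [] ]
setPartitions (suc n) = concatMap (insertions (suc n)) (setPartitions n)

IsInterval : Block → Set
IsInterval = Linked (λ x y → y ≡ suc x)

IsLayeredMatching : Partition → Set
IsLayeredMatching = All (λ B → IsInterval B × (length B ≡ 1 ⊎ length B ≡ 2))

isLayeredMatching? : (π : Partition) → Dec (IsLayeredMatching π)
isLayeredMatching? = all? λ B →
  linked? (λ x y → y ≟ suc x) B ×-dec (length B ≟ 1 ⊎-dec length B ≟ 2)

-- Πₙ(13/2, 123)
layeredMatchings : ℕ → List Partition
layeredMatchings n = filter isLayeredMatching? (setPartitions n)

-- The number of pairs (b , Bⱼ) with b ∈ Bᵢ, j > i and max Bⱼ > b.  The first
-- argument of max is its value on the empty list, which is never a block.
rb : Partition → ℕ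
rb []      = 0
rb (B ∷ π) = length (filter (λ (b , C) → b <? max 0 C) (cartesianProduct B π)) + rb π

F : ℕ → Poly
F n = ∑[ π ∈ layeredMatchings n ] q^ (rb π)

{-# OPTIONS --safe #-}
-- In a layered matching every element of a block is smaller than the maximum
-- of every later block, so appending a last block to a layered matching of [n]
-- raises rb by n.  Splitting by the size of the last block gives
--   F (n + 2) = q^(n + 1) F (n + 1) + q^n F n,
-- and the identity follows by induction on n: multiplying it by 1 + q^(n + 1)
-- turns F (n + 1) into F (n + 2) + q^(n - 1) F (n - 1), whose second part is
-- the new summand k = n - 1.
module Submission where

open import Algebra.Bundles using (CommutativeMonoid; CommutativeSemiring)
open import Algebra.Structures using (IsCommutativeMonoid)
open import Data.Bool using (true; false; if_then_else_)
open import Data.List using (List; []; _∷_; _++_; _∷ʳ_; [_]; map; filter; concat; concatMap; length; cartesianProduct; upTo)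
open import Data.List.Extrema.Nat using (max; v<max⁺)
open import Data.List.Properties using (applyUpTo-∷ʳ; cartesianProductWith-zeroʳ; filter-++; filter-accept; length-++; length-++-sucʳ; map-++; map-∘; ++-assoc)
open import Data.List.Relation.Unary.All as All using (All; []; _∷_)
open import Data.List.Relation.Unary.All.Properties using (all-upTo; concat⁺; map⁺; ++⁺; ∷ʳ⁺; ∷ʳ⁻)
open import Data.List.Relation.Unary.Any using (here)
open import Data.List.Relation.Unary.Linked using ([-]; _∷_)
open import Data.Nat using (ℕ; zero; suc; _+_; _*_; _∸_; _≤_; _<_; _<?_; z≤n; s≤s)
open import Data.Nat.Properties
open import Data.Nat.Tactic.RingSolver using (solve-∀)
open import Data.Product using (_×_; _,_; proj₁)
open import Data.Sum using (inj₁; inj₂)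
open import Function using (_∘_; mk⇔)
open import Level using (0ℓ)
open import Relation.Binary.PropositionalEquality using (_≡_; _≢_; refl; sym; trans; cong; cong₂; subst; module ≡-Reasoning)
open import Relation.Binary.Structures using (IsEquivalence)
open import Relation.Nullary using (¬_; does)
open import Relation.Nullary.Decidable using (dec-false; does-⇔)
open import Relation.Unary using (Pred; Decidable)
open import Defs

-- The semiring of polynomials

-- _≈_ wrapped in a record, so that its arguments can be inferred.
infix 4 _≃_
record _≃_ (p r : Poly) : Set where
  constructor mk≃
  field at : p ≈ r
open _≃_

≃-isEquivalence : IsEquivalence _≃_
≃-isEquivalence = record
  { refl  = mk≃ λ _ → refl
  ; sym   = λ p≃r → mk≃ λ i → sym (at p≃r i)
  ; trans = λ p≃r r≃s → mk≃ λ i → trans (at p≃r i) (at r≃s i)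
  }

open IsEquivalence ≃-isEquivalence using ()
  renaming (refl to ≃-refl; sym to ≃-sym; trans to ≃-trans; reflexive to ≃-reflexive)

coeff-⊕ : ∀ p r i → coeff (p ⊕ r) i ≡ coeff p i + coeff r i
coeff-⊕ []      r       i       = refl
coeff-⊕ (a ∷ p) []      i       = sym (+-identityʳ _)
coeff-⊕ (a ∷ p) (b ∷ r) zero    = refl
coeff-⊕ (a ∷ p) (b ∷ r) (suc i) = coeff-⊕ p r i

⊕-cong : ∀ {p p′ r r′} → p ≃ p′ → r ≃ r′ → p ⊕ r ≃ p′ ⊕ r′
⊕-cong {p} {p′} {r} {r′} p≃ r≃ = mk≃ λ i → begin
  coeff (p ⊕ r) i          ≡⟨ coeff-⊕ p r i ⟩
  coeff p i + coeff r i    ≡⟨ cong₂ _+_ (at p≃ i) (at r≃ i) ⟩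
  coeff p′ i + coeff r′ i  ≡⟨ coeff-⊕ p′ r′ i ⟨
  coeff (p′ ⊕ r′) i        ∎
  where open ≡-Reasoning

⊕-assoc : ∀ p r s → (p ⊕ r) ⊕ s ≃ p ⊕ (r ⊕ s)
⊕-assoc p r s = mk≃ λ i → begin
  coeff (p ⊕ r ⊕ s) i                    ≡⟨ coeff-⊕ (p ⊕ r) s i ⟩
  coeff (p ⊕ r) i + coeff s i            ≡⟨ cong (_+ coeff s i) (coeff-⊕ p r i) ⟩
  coeff p i + coeff r i + coeff s i      ≡⟨ +-assoc (coeff p i) _ _ ⟩
  coeff p i + (coeff r i + coeff s i)    ≡⟨ cong (coeff p i +_) (coeff-⊕ r s i) ⟨
  coeff p i + coeff (r ⊕ s) i            ≡⟨ coeff-⊕ p (r ⊕ s) i ⟨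
  coeff (p ⊕ (r ⊕ s)) i                  ∎
  where open ≡-Reasoning

⊕-comm : ∀ p r → p ⊕ r ≃ r ⊕ p
⊕-comm p r = mk≃ λ i →
  trans (coeff-⊕ p r i) (trans (+-comm (coeff p i) _) (sym (coeff-⊕ r p i)))

open import Algebra.Structures.Biased _≃_ using (isCommutativeMonoidˡ; isCommutativeSemiringˡ)

⊕-isCommutativeMonoid : IsCommutativeMonoid _≃_ _⊕_ 0ₚ
⊕-isCommutativeMonoid = isCommutativeMonoidˡ record
  { isSemigroup = record
    { isMagma = record { isEquivalence = ≃-isEquivalence ; ∙-cong = ⊕-cong }
    ; assoc   = ⊕-assoc
    }
  ; identityˡ = λ _ → ≃-refl
  ; comm      = ⊕-comm
  }

⊕-commutativeMonoid : CommutativeMonoid 0ℓ 0ℓ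
⊕-commutativeMonoid = record { isCommutativeMonoid = ⊕-isCommutativeMonoid }

open CommutativeMonoid ⊕-commutativeMonoid using (commutativeSemigroup)
  renaming (setoid to ≃-setoid; identityʳ to ⊕-identityʳ)
open import Algebra.Properties.CommutativeSemigroup commutativeSemigroup
  using (interchange; x∙yz≈y∙xz)
open import Relation.Binary.Reasoning.Setoid ≃-setoid

∷-cong : ∀ {a b p r} → a ≡ b → p ≃ r → a ∷ p ≃ b ∷ r
∷-cong a≡b p≃r = mk≃ λ { zero → a≡b ; (suc i) → at p≃r i }

0∷0ₚ : 0 ∷ 0ₚ ≃ 0ₚ
0∷0ₚ = mk≃ λ { zero → refl ; (suc _) → refl }

scale : ℕ → Poly → Poly
scale a = map (a *_)

coeff-scale : ∀ a p i → coeff (scale a p) i ≡ a * coeff p i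
coeff-scale a []      i       = sym (*-zeroʳ a)
coeff-scale a (b ∷ p) zero    = refl
coeff-scale a (b ∷ p) (suc i) = coeff-scale a p i

scale-cong : ∀ a {p r} → p ≃ r → scale a p ≃ scale a r
scale-cong a {p} {r} p≃r = mk≃ λ i →
  trans (coeff-scale a p i) (trans (cong (a *_) (at p≃r i)) (sym (coeff-scale a r i)))

scale-zeroˡ : ∀ p → scale 0 p ≃ 0ₚ
scale-zeroˡ p = mk≃ (coeff-scale 0 p)

scale-identityˡ : ∀ p → scale 1 p ≃ p
scale-identityˡ p = mk≃ λ i → trans (coeff-scale 1 p i) (*-identityˡ _)

scale-scale : ∀ a b p → scale (a * b) p ≃ scale a (scale b p)
scale-scale a b []      = ≃-refl
scale-scale a b (c ∷ p) = ∷-cong (*-assoc a b c) (scale-scale a b p)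

scale-distribˡ : ∀ a p r → scale a (p ⊕ r) ≃ scale a p ⊕ scale a r
scale-distribˡ a []      r       = ≃-refl
scale-distribˡ a (b ∷ p) []      = ≃-refl
scale-distribˡ a (b ∷ p) (c ∷ r) = ∷-cong (*-distribˡ-+ a b c) (scale-distribˡ a p r)

scale-distribʳ : ∀ a b p → scale (a + b) p ≃ scale a p ⊕ scale b p
scale-distribʳ a b []      = ≃-refl
scale-distribʳ a b (c ∷ p) = ∷-cong (*-distribʳ-+ c a b) (scale-distribʳ a b p)

⊗-zeroʳ : ∀ p → p ⊗ 0ₚ ≃ 0ₚ
⊗-zeroʳ []      = ≃-refl
⊗-zeroʳ (a ∷ p) = ≃-trans (∷-cong refl (⊗-zeroʳ p)) 0∷0ₚ

-- Mirror image of the defining clause of `_⊗_`, which recurses on the left factor; with it,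
-- commutativity follows by induction on one factor.
⊗-∷ : ∀ p b r → p ⊗ (b ∷ r) ≃ scale b p ⊕ (0 ∷ (p ⊗ r))
⊗-∷ []      b r = ≃-sym 0∷0ₚ
⊗-∷ (a ∷ p) b r = ∷-cong (cong (_+ 0) (*-comm a b)) (begin
  scale a r ⊕ p ⊗ (b ∷ r)                    ≈⟨ ⊕-cong ≃-refl (⊗-∷ p b r) ⟩
  scale a r ⊕ (scale b p ⊕ (0 ∷ (p ⊗ r)))    ≈⟨ x∙yz≈y∙xz (scale a r) (scale b p) _ ⟩
  scale b p ⊕ (scale a r ⊕ (0 ∷ (p ⊗ r)))    ∎)

⊗-comm : ∀ p r → p ⊗ r ≃ r ⊗ p
⊗-comm []      r = ≃-sym (⊗-zeroʳ r)
⊗-comm (a ∷ p) r = begin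
  scale a r ⊕ (0 ∷ (p ⊗ r))  ≈⟨ ⊕-cong (≃-refl {scale a r}) (∷-cong refl (⊗-comm p r)) ⟩
  scale a r ⊕ (0 ∷ (r ⊗ p))  ≈⟨ ⊗-∷ r a p ⟨
  r ⊗ (a ∷ p)                ∎

⊗-congˡ : ∀ p {r s} → r ≃ s → p ⊗ r ≃ p ⊗ s
⊗-congˡ []      r≃s = ≃-refl
⊗-congˡ (a ∷ p) r≃s = ⊕-cong (scale-cong a r≃s) (∷-cong refl (⊗-congˡ p r≃s))

-- Equal polynomials may be lists of different lengths, so recursion on two left factors at once
-- would be awkward. Commutativity moves each left factor to the right, where congruence is already
-- known.
⊗-cong : ∀ {p p′ r r′} → p ≃ p′ → r ≃ r′ → p ⊗ r ≃ p′ ⊗ r′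
⊗-cong {p} {p′} {r} {r′} p≃ r≃ = begin
  p ⊗ r    ≈⟨ ⊗-congˡ p r≃ ⟩
  p ⊗ r′   ≈⟨ ⊗-comm p r′ ⟩
  r′ ⊗ p   ≈⟨ ⊗-congˡ r′ p≃ ⟩
  r′ ⊗ p′  ≈⟨ ⊗-comm r′ p′ ⟩
  p′ ⊗ r′  ∎

⊗-distribʳ : ∀ s p r → (p ⊕ r) ⊗ s ≃ p ⊗ s ⊕ r ⊗ s
⊗-distribʳ s []      r       = ≃-refl
⊗-distribʳ s (a ∷ p) []      = ≃-sym (⊕-identityʳ _)
⊗-distribʳ s (a ∷ p) (b ∷ r) = begin
  scale (a + b) s ⊕ (0 ∷ ((p ⊕ r) ⊗ s))
    ≈⟨ ⊕-cong (scale-distribʳ a b s) (∷-cong refl (⊗-distribʳ s p r)) ⟩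
  (scale a s ⊕ scale b s) ⊕ ((0 ∷ (p ⊗ s)) ⊕ (0 ∷ (r ⊗ s)))
    ≈⟨ interchange (scale a s) (scale b s) (0 ∷ (p ⊗ s)) (0 ∷ (r ⊗ s)) ⟩
  (scale a s ⊕ (0 ∷ (p ⊗ s))) ⊕ (scale b s ⊕ (0 ∷ (r ⊗ s))) ∎

0∷-⊗ : ∀ p r → (0 ∷ p) ⊗ r ≃ 0 ∷ (p ⊗ r)
0∷-⊗ p r = ⊕-cong (scale-zeroˡ r) ≃-refl

scale-⊗ : ∀ a p r → scale a p ⊗ r ≃ scale a (p ⊗ r)
scale-⊗ a []      r = ≃-refl
scale-⊗ a (b ∷ p) r = begin
  scale (a * b) r ⊕ (0 ∷ (scale a p ⊗ r))
    -- The leading `0` is rewritten as `a * 0`, so that the shifted tail is itself a multiple by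
    -- `a`.
    ≈⟨ ⊕-cong (scale-scale a b r) (∷-cong (sym (*-zeroʳ a)) (scale-⊗ a p r)) ⟩
  scale a (scale b r) ⊕ scale a (0 ∷ (p ⊗ r))
    ≈⟨ scale-distribˡ a (scale b r) _ ⟨
  scale a (scale b r ⊕ (0 ∷ (p ⊗ r))) ∎

⊗-assoc : ∀ p r s → (p ⊗ r) ⊗ s ≃ p ⊗ (r ⊗ s)
⊗-assoc []      r s = ≃-refl
⊗-assoc (a ∷ p) r s = begin
  (scale a r ⊕ (0 ∷ (p ⊗ r))) ⊗ s
    ≈⟨ ⊗-distribʳ s (scale a r) (0 ∷ (p ⊗ r)) ⟩
  scale a r ⊗ s ⊕ (0 ∷ (p ⊗ r)) ⊗ s
    ≈⟨ ⊕-cong (scale-⊗ a r s) (≃-trans (0∷-⊗ (p ⊗ r) s) (∷-cong refl (⊗-assoc p r s))) ⟩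
  scale a (r ⊗ s) ⊕ (0 ∷ (p ⊗ (r ⊗ s))) ∎

⊗-identityˡ : ∀ p → 1ₚ ⊗ p ≃ p
⊗-identityˡ p = begin
  scale 1 p ⊕ (0 ∷ 0ₚ)  ≈⟨ ⊕-cong (scale-identityˡ p) 0∷0ₚ ⟩
  p ⊕ 0ₚ                ≈⟨ ⊕-identityʳ p ⟩
  p                     ∎

polySemiring : CommutativeSemiring 0ℓ 0ℓ
polySemiring = record
  { _≈_ = _≃_ ; _+_ = _⊕_ ; _*_ = _⊗_ ; 0# = 0ₚ ; 1# = 1ₚ
  ; isCommutativeSemiring = isCommutativeSemiringˡ record
    { +-isCommutativeMonoid = ⊕-isCommutativeMonoid
    ; *-isCommutativeMonoid = isCommutativeMonoidˡ record
      { isSemigroup = record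
        { isMagma = record { isEquivalence = ≃-isEquivalence ; ∙-cong = ⊗-cong }
        ; assoc   = ⊗-assoc
        }
      ; identityˡ = ⊗-identityˡ
      ; comm      = ⊗-comm
      }
    ; distribʳ = ⊗-distribʳ
    ; zeroˡ    = λ _ → ≃-refl
    }
  }

open CommutativeSemiring polySemiring using ()
  renaming (*-identityʳ to ⊗-identityʳ; distribˡ to ⊗-distribˡ)

open import Algebra.Solver.Ring.NaturalCoefficients.Default polySemiring
  using (solve; _:=_; _:+_; _:*_; con)

q^-+ : ∀ m n → q^ (m + n) ≃ q^ m ⊗ q^ n
q^-+ zero    n = ≃-sym (⊗-identityˡ (q^ n))
q^-+ (suc m) n = ≃-trans (∷-cong refl (q^-+ m n)) (≃-sym (0∷-⊗ (q^ m) (q^ n)))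

-- Finite sums and products

module _ {A : Set} where

  -- Equality is asked only at the entries of the list, because the identities summed later rest on
  -- invariants of those entries: being a partition of [n], or an index below n.
  sumOver-cong : ∀ {xs : List A} {f g} → All (λ x → f x ≃ g x) xs → sumOver xs f ≃ sumOver xs g
  sumOver-cong []         = ≃-refl
  sumOver-cong (eq ∷ eqs) = ⊕-cong eq (sumOver-cong eqs)

  sumOver-zero : ∀ {xs : List A} {f} → All (λ x → f x ≃ 0ₚ) xs → sumOver xs f ≃ 0ₚ
  sumOver-zero []         = ≃-refl
  sumOver-zero (eq ∷ eqs) = ⊕-cong eq (sumOver-zero eqs)

  sumOver-++ : ∀ (xs ys : List A) f → sumOver (xs ++ ys) f ≃ sumOver xs f ⊕ sumOver ys f
  sumOver-++ []       ys f = ≃-refl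
  sumOver-++ (x ∷ xs) ys f =
    ≃-trans (⊕-cong ≃-refl (sumOver-++ xs ys f)) (≃-sym (⊕-assoc (f x) _ _))

  sumOver-∷ʳ : ∀ (xs : List A) x f → sumOver (xs ∷ʳ x) f ≃ sumOver xs f ⊕ f x
  sumOver-∷ʳ xs x f = ≃-trans (sumOver-++ xs [ x ] f) (⊕-cong (≃-refl {sumOver xs f}) (⊕-identityʳ (f x)))

  sumOver-⊕ : ∀ (xs : List A) f g → (∑[ x ∈ xs ] (f x ⊕ g x)) ≃ sumOver xs f ⊕ sumOver xs g
  sumOver-⊕ []       f g = ≃-refl
  sumOver-⊕ (x ∷ xs) f g =
    ≃-trans (⊕-cong ≃-refl (sumOver-⊕ xs f g)) (interchange (f x) (g x) _ _)

  sumOver-⊗ˡ : ∀ (xs : List A) p f → (∑[ x ∈ xs ] (p ⊗ f x)) ≃ p ⊗ sumOver xs f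
  sumOver-⊗ˡ []       p f = ≃-sym (⊗-zeroʳ p)
  sumOver-⊗ˡ (x ∷ xs) p f =
    ≃-trans (⊕-cong ≃-refl (sumOver-⊗ˡ xs p f)) (≃-sym (⊗-distribˡ p (f x) _))

  sumOver-⊗ʳ : ∀ (xs : List A) f p → (∑[ x ∈ xs ] (f x ⊗ p)) ≃ sumOver xs f ⊗ p
  sumOver-⊗ʳ []       f p = ≃-refl
  sumOver-⊗ʳ (x ∷ xs) f p =
    ≃-trans (⊕-cong ≃-refl (sumOver-⊗ʳ xs f p)) (≃-sym (⊗-distribʳ p (f x) _))

  sumOver-concatMap : ∀ {B : Set} (xs : List B) (g : B → List A) f →
    sumOver (concatMap g xs) f ≃ (∑[ x ∈ xs ] sumOver (g x) f)
  sumOver-concatMap []       g f = ≃-refl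
  sumOver-concatMap (x ∷ xs) g f =
    ≃-trans (sumOver-++ (g x) _ f) (⊕-cong ≃-refl (sumOver-concatMap xs g f))

  sumOver-filter : ∀ {P : Pred A 0ℓ} (P? : Decidable P) xs f →
    sumOver (filter P? xs) f ≃ (∑[ x ∈ xs ] (if does (P? x) then f x else 0ₚ))
  sumOver-filter P? []       f = ≃-refl
  sumOver-filter P? (x ∷ xs) f with does (P? x)
  ... | true  = ⊕-cong ≃-refl (sumOver-filter P? xs f)
  ... | false = sumOver-filter P? xs f

  prodOver-∷ʳ : ∀ (xs : List A) x f → prodOver (xs ∷ʳ x) f ≃ prodOver xs f ⊗ f x
  prodOver-∷ʳ []       x f = ⊗-comm (f x) 1ₚ
  prodOver-∷ʳ (y ∷ xs) x f =
    ≃-trans (⊗-congˡ (f y) (prodOver-∷ʳ xs x f)) (≃-sym (⊗-assoc (f y) _ _))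

range-∷ʳ : ∀ {a n} → a ≤ suc n → range a (suc n) ≡ range a n ∷ʳ suc n
range-∷ʳ {a} {n} a≤1+n rewrite +-∸-assoc 1 a≤1+n =
  trans (sym (applyUpTo-∷ʳ (a +_) (suc n ∸ a))) (cong (range a n ∷ʳ_) (m+[n∸m]≡n a≤1+n))

range-empty : ∀ {a n} → n < a → range a n ≡ []
range-empty {a} {n} n<a rewrite m≤n⇒m∸n≡0 n<a = refl

-- The recurrence for F

module ≡ = ≡-Reasoning

below? : Decidable λ ((b , C) : ℕ × Block) → b < max 0 C
below? (b , C) = b <? max 0 C

count : List (ℕ × Block) → ℕ
count = length ∘ filter below?

count-++ : ∀ ps qs → count (ps ++ qs) ≡ count ps + count qs
count-++ ps qs = trans (cong length (filter-++ below? ps qs)) (length-++ (filter below? ps))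

count-map-∷ʳ : ∀ b (π : Partition) {C} → b < max 0 C →
  count (map (b ,_) (π ∷ʳ C)) ≡ suc (count (map (b ,_) π))
count-map-∷ʳ b []      {C} b<C = cong length (filter-accept below? {x = b , C} {xs = []} b<C)
count-map-∷ʳ b (D ∷ π) {C} b<C with does (b <? max 0 D)
... | true  = cong suc (count-map-∷ʳ b π b<C)
... | false = count-map-∷ʳ b π b<C

-- Each `b` in `B` gains exactly one counted pair, the one with `C`.
count-cartesianProduct-∷ʳ : ∀ {B} (π : Partition) {C} → All (_< max 0 C) B →
  count (cartesianProduct B (π ∷ʳ C)) ≡ length B + count (cartesianProduct B π)
count-cartesianProduct-∷ʳ π []                      = refl
count-cartesianProduct-∷ʳ {b ∷ B} π {C} (b<C ∷ B<C) = ≡.begin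
  count (map (b ,_) (π ∷ʳ C) ++ cartesianProduct B (π ∷ʳ C))
    ≡.≡⟨ count-++ (map (b ,_) (π ∷ʳ C)) _ ⟩
  count (map (b ,_) (π ∷ʳ C)) + count (cartesianProduct B (π ∷ʳ C))
    ≡.≡⟨ cong₂ _+_ (count-map-∷ʳ b π b<C) (count-cartesianProduct-∷ʳ π B<C) ⟩
  suc (count (map (b ,_) π)) + (length B + count (cartesianProduct B π))
    ≡.≡⟨ swap (count (map (b ,_) π)) (length B) _ ⟩
  suc (length B) + (count (map (b ,_) π) + count (cartesianProduct B π))
    ≡.≡⟨ cong (suc (length B) +_) (count-++ (map (b ,_) π) _) ⟨
  suc (length B) + count (map (b ,_) π ++ cartesianProduct B π) ≡.∎
  where
  swap : ∀ x y z → suc x + (y + z) ≡ suc y + (x + z)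
  swap = solve-∀

size : Partition → ℕ
size π = length (concat π)

-- Pairs among the old blocks are unaffected, every old element gains the pair with `C`, and the
-- elements of `C` have no later block.
rb-∷ʳ : ∀ {π C} → All (All (_< max 0 C)) π → rb (π ∷ʳ C) ≡ size π + rb π
rb-∷ʳ {C = C} [] rewrite cartesianProductWith-zeroʳ {B = Block} _,_ C = refl
rb-∷ʳ {B ∷ π} {C} (B<C ∷ π<C) = ≡.begin
  count (cartesianProduct B (π ∷ʳ C)) + rb (π ∷ʳ C)
    ≡.≡⟨ cong₂ _+_ (count-cartesianProduct-∷ʳ π B<C) (rb-∷ʳ π<C) ⟩
  (length B + count (cartesianProduct B π)) + (size π + rb π)
    ≡.≡⟨ swap (length B) _ (size π) (rb π) ⟩
  (length B + size π) + (count (cartesianProduct B π) + rb π)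
    ≡.≡⟨ cong (_+ rb (B ∷ π)) (length-++ B) ⟨
  size (B ∷ π) + rb (B ∷ π) ≡.∎
  where
  swap : ∀ x y z w → (x + y) + (z + w) ≡ (x + z) + (y + w)
  swap = solve-∀

-- Giving weight zero to the other partitions turns `F n` into a sum over all of `setPartitions n`,
-- which unfolds along `insertions`.
weight : Partition → Poly
weight π = if does (isLayeredMatching? π) then q^ (rb π) else 0ₚ

F≃∑weight : ∀ n → F n ≃ sumOver (setPartitions n) weight
F≃∑weight n = sumOver-filter isLayeredMatching? (setPartitions n) (λ π → q^ (rb π))

weight-zero : ∀ {π} → ¬ IsLayeredMatching π → weight π ≃ 0ₚ
weight-zero {π} ¬lm rewrite dec-false (isLayeredMatching? π) ¬lm = ≃-refl

weight-∷ʳ : ∀ {π C} → IsLayeredMatching [ C ] → All (All (_< max 0 C)) π →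
  weight (π ∷ʳ C) ≃ q^ (size π) ⊗ weight π
weight-∷ʳ {π} {C} lmC π<C = begin
  weight (π ∷ʳ C)
    ≡⟨ cong₂ (λ b k → if b then q^ k else 0ₚ)
             -- As `C` is itself an admissible block, `π ∷ʳ C` is layered exactly when `π` is, so
             -- both decisions yield the same Boolean.
             (does-⇔ (mk⇔ (proj₁ ∘ ∷ʳ⁻) (λ lm → ++⁺ lm lmC)) (isLayeredMatching? (π ∷ʳ C)) (isLayeredMatching? π))
             (rb-∷ʳ π<C) ⟩
  (if does (isLayeredMatching? π) then q^ (size π + rb π) else 0ₚ)
    ≈⟨ shift (does (isLayeredMatching? π)) ⟩
  q^ (size π) ⊗ weight π ∎
  where
  shift : ∀ b → (if b then q^ (size π + rb π) else 0ₚ) ≃ q^ (size π) ⊗ (if b then q^ (rb π) else 0ₚ)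
  shift true  = q^-+ (size π) (rb π)
  shift false = ≃-sym (⊗-zeroʳ (q^ (size π)))

-- The insertions of m into one of the existing blocks.
extensions : ℕ → Partition → List Partition
extensions m []      = []
extensions m (B ∷ π) = ((B ∷ʳ m) ∷ π) ∷ map (B ∷_) (extensions m π)

-- Separates the case where `m` is alone in its block, which `insertions` lists last.
insertions≡extensions∷ʳ : ∀ m π → insertions m π ≡ extensions m π ∷ʳ (π ∷ʳ [ m ])
insertions≡extensions∷ʳ m []      = refl
insertions≡extensions∷ʳ m (B ∷ π) = cong (((B ∷ʳ m) ∷ π) ∷_)
  (trans (cong (map (B ∷_)) (insertions≡extensions∷ʳ m π)) (map-++ (B ∷_) (extensions m π) _))

-- Isolates the insertion into the last block. For `C` the singleton of the previous element, it is
-- the only one that can produce a layered matching.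
extensions-∷ʳ : ∀ m π C → extensions m (π ∷ʳ C) ≡ map (_∷ʳ C) (extensions m π) ∷ʳ (π ∷ʳ (C ∷ʳ m))
extensions-∷ʳ m []      C = refl
extensions-∷ʳ m (B ∷ π) C = cong (((B ∷ʳ m) ∷ (π ∷ʳ C)) ∷_) (≡.begin
  map (B ∷_) (extensions m (π ∷ʳ C))
    ≡.≡⟨ cong (map (B ∷_)) (extensions-∷ʳ m π C) ⟩
  map (B ∷_) (map (_∷ʳ C) (extensions m π) ∷ʳ (π ∷ʳ (C ∷ʳ m)))
    ≡.≡⟨ map-++ (B ∷_) (map (_∷ʳ C) (extensions m π)) _ ⟩
  map (B ∷_) (map (_∷ʳ C) (extensions m π)) ∷ʳ (B ∷ (π ∷ʳ (C ∷ʳ m)))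
    -- Prepending `B` and appending `C` commute by computation, so fusing the two maps and splitting
    -- them again exchanges their order.
    ≡.≡⟨ cong (_∷ʳ (B ∷ (π ∷ʳ (C ∷ʳ m)))) (trans (sym (map-∘ (extensions m π))) (map-∘ (extensions m π))) ⟩
  map (_∷ʳ C) (map (B ∷_) (extensions m π)) ∷ʳ (B ∷ (π ∷ʳ (C ∷ʳ m))) ≡.∎)

∷ʳ-nonempty : ∀ (B : Block) {m} → B ∷ʳ m ≢ []
∷ʳ-nonempty []      ()
∷ʳ-nonempty (_ ∷ _) ()

-- Excludes the two blocks that become admissible when `suc m` is added at the end: the empty one
-- and `[ m ]`.
NonSingleton : ℕ → Partition → Set
NonSingleton m = All (λ B → B ≢ [] × B ≢ [ m ])

-- A nonempty block that receives `m` has at least two elements, so no block `[ m ]` can arise.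
extensions-nonSingleton : ∀ {m π} → NonSingleton m π → All (NonSingleton m) (extensions m π)
extensions-nonSingleton []                  = []
extensions-nonSingleton {m} {B ∷ π} (nB ∷ nπ) =
  ((∷ʳ-nonempty B , nonsingleton B (proj₁ nB)) ∷ nπ) ∷ map⁺ (All.map (nB ∷_) (extensions-nonSingleton nπ))
  where
  nonsingleton : ∀ B → B ≢ [] → B ∷ʳ m ≢ [ m ]
  nonsingleton []          B≢[] _ = B≢[] refl
  nonsingleton (_ ∷ [])    _ ()
  nonsingleton (_ ∷ _ ∷ _) _ ()

-- An admissible block ending in `suc m` is `[ suc m ]` or consists of `m` and `suc m`; the
-- hypothesis rules out the block that either would come from.
extensions-notLayered : ∀ {m π} → NonSingleton m π → All (¬_ ∘ IsLayeredMatching) (extensions (suc m) π)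
extensions-notLayered []                            = []
extensions-notLayered {m} {B ∷ π} ((B≢[] , B≢[m]) ∷ nπ) =
  (λ { (ok ∷ _) → notLayered B B≢[] B≢[m] (ok ∷ []) })
    ∷ map⁺ (All.map (λ { ¬lm (_ ∷ lm) → ¬lm lm }) (extensions-notLayered nπ))
  where
  notLayered : ∀ B → B ≢ [] → B ≢ [ m ] → ¬ IsLayeredMatching [ B ∷ʳ suc m ]
  notLayered []              B≢[] _     _                                = B≢[] refl
  -- The interval condition equates `suc m` with the successor of the single entry, which is
  -- therefore `m`.
  notLayered (_ ∷ [])        _    B≢[m] ((refl ∷ _ , _) ∷ [])            = B≢[m] refl
  -- From here on the enlarged block has at least three elements. Splitting on the third entry of
  -- `B` lets its length compute far enough to differ visibly from 1 and 2.
  notLayered (_ ∷ _ ∷ [])    _    _     ((_ , inj₁ ()) ∷ [])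
  notLayered (_ ∷ _ ∷ [])    _    _     ((_ , inj₂ ()) ∷ [])
  notLayered (_ ∷ _ ∷ _ ∷ _) _    _     ((_ , inj₁ ()) ∷ [])
  notLayered (_ ∷ _ ∷ _ ∷ _) _    _     ((_ , inj₂ ()) ∷ [])

∑extensions-zero : ∀ {m π} → NonSingleton m π → sumOver (extensions (suc m) π) weight ≃ 0ₚ
∑extensions-zero nπ = sumOver-zero (All.map weight-zero (extensions-notLayered nπ))

BlocksWithin : ℕ → Partition → Set
BlocksWithin n = All (λ B → B ≢ [] × All (_≤ n) B)

insertions-blocksWithin : ∀ {n π} → BlocksWithin n π → All (BlocksWithin (suc n)) (insertions (suc n) π)
insertions-blocksWithin [] = (((λ ()) , ≤-refl ∷ []) ∷ []) ∷ []
insertions-blocksWithin {n} {B ∷ π} ((B≢[] , B≤n) ∷ π≤n) =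
  ((∷ʳ-nonempty B , ∷ʳ⁺ (All.map m≤n⇒m≤1+n B≤n) ≤-refl) ∷ All.map (λ (C≢[] , C≤n) → C≢[] , All.map m≤n⇒m≤1+n C≤n) π≤n)
    ∷ map⁺ (All.map ((B≢[] , All.map m≤n⇒m≤1+n B≤n) ∷_) (insertions-blocksWithin π≤n))

insertions-size : ∀ m π → All (λ ρ → size ρ ≡ suc (size π)) (insertions m π)
insertions-size m []      = refl ∷ []
insertions-size m (B ∷ π) = head ∷ map⁺ (All.map (λ {ρ} → tail {ρ}) (insertions-size m π))
  where
  head : size ((B ∷ʳ m) ∷ π) ≡ suc (size (B ∷ π))
  head = trans (cong length (++-assoc B [ m ] (concat π))) (length-++-sucʳ B m (concat π))
  tail : ∀ {ρ} → size ρ ≡ suc (size π) → size (B ∷ ρ) ≡ suc (size (B ∷ π))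
  tail {ρ} eq = trans (length-++ B)
    (trans (cong (length B +_) eq) (trans (+-suc (length B) _) (cong suc (sym (length-++ B)))))

-- The invariants behind the recurrence: the size gives the exponent of q, and the bound puts all
-- elements below the maximum of a block appended later.
PartitionOf : ℕ → Partition → Set
PartitionOf n π = BlocksWithin n π × size π ≡ n

setPartitions-partitionOf : ∀ n → All (PartitionOf n) (setPartitions n)
setPartitions-partitionOf zero    = ([] , refl) ∷ []
setPartitions-partitionOf (suc n) = concat⁺ (map⁺ (All.map step (setPartitions-partitionOf n)))
  where
  step : ∀ {π} → PartitionOf n π → All (PartitionOf (suc n)) (insertions (suc n) π)
  step {π} (π≤n , ∣π∣) = All.zip
    (insertions-blocksWithin π≤n , All.map (λ eq → trans eq (cong suc ∣π∣)) (insertions-size (suc n) π))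

blocksWithin⇒nonSingleton : ∀ {n π} → BlocksWithin n π → NonSingleton (suc n) π
blocksWithin⇒nonSingleton = All.map λ { (B≢[] , B≤n) → B≢[] , λ { refl → 1+n≰n (All.head B≤n) } }

weight-append : ∀ {n π C} → IsLayeredMatching [ suc n ∷ C ] → PartitionOf n π →
  weight (π ∷ʳ (suc n ∷ C)) ≃ q^ n ⊗ weight π
weight-append {n} {π} {C} lm (π≤n , refl) = weight-∷ʳ lm (All.map
  -- The head `suc n` of the new block is the entry that exceeds `b`; `0` is the value of `max` on
  -- the empty list.
  (λ (_ , B≤n) → All.map (λ b≤n → v<max⁺ 0 (suc n ∷ C) (inj₂ (here (s≤s b≤n)))) B≤n) π≤n)

-- When n + 2 joins an existing block, a layered matching results only if n + 1 had opened a block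
-- of its own and n + 2 joins that one. The last block then has size two and follows n elements.
∑insertions-∑extensions : ∀ {n π} → PartitionOf n π →
  (∑[ ρ ∈ insertions (1 + n) π ] sumOver (extensions (2 + n) ρ) weight) ≃ q^ n ⊗ weight π
∑insertions-∑extensions {n} {π} part@(π≤n , _)
  rewrite insertions≡extensions∷ʳ (suc n) π = begin
  sumOver (extensions (1 + n) π ∷ʳ (π ∷ʳ [ 1 + n ])) f
    ≈⟨ sumOver-∷ʳ (extensions (1 + n) π) _ f ⟩
  sumOver (extensions (1 + n) π) f ⊕ f (π ∷ʳ [ 1 + n ])
    -- Here n + 1 has joined an old block, so n + 2 finds no block `[ 1 + n ]` to complete.
    ≈⟨ ⊕-cong (sumOver-zero (All.map ∑extensions-zero (extensions-nonSingleton nπ))) ≃-refl ⟩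
  f (π ∷ʳ [ 1 + n ])
    ≈⟨ ≃-reflexive (cong (λ ρs → sumOver ρs weight) (extensions-∷ʳ (2 + n) π [ 1 + n ])) ⟩
  sumOver (map (_∷ʳ [ 1 + n ]) (extensions (2 + n) π) ∷ʳ (π ∷ʳ (1 + n ∷ 2 + n ∷ []))) weight
    ≈⟨ sumOver-∷ʳ (map (_∷ʳ [ 1 + n ]) (extensions (2 + n) π)) _ weight ⟩
  sumOver (map (_∷ʳ [ 1 + n ]) (extensions (2 + n) π)) weight ⊕ weight (π ∷ʳ (1 + n ∷ 2 + n ∷ []))
    -- Here n + 2 joins a block of `π` and skips `[ 1 + n ]`; the part before the last block already
    -- fails to be layered.
    ≈⟨ ⊕-cong (sumOver-zero (map⁺ (All.map (λ ¬lm → weight-zero (¬lm ∘ proj₁ ∘ ∷ʳ⁻)) (extensions-notLayered nπ))))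
              (weight-append ((refl ∷ [-] , inj₂ refl) ∷ []) part) ⟩
  q^ n ⊗ weight π ∎
  where
  nπ : NonSingleton (suc n) π
  nπ = blocksWithin⇒nonSingleton π≤n
  f : Partition → Poly
  f ρ = sumOver (extensions (2 + n) ρ) weight

F-recurrence : ∀ n → F (2 + n) ≃ q^ (1 + n) ⊗ F (1 + n) ⊕ q^ n ⊗ F n
F-recurrence n = begin
  F (2 + n)
    ≈⟨ F≃∑weight (2 + n) ⟩
  sumOver (concatMap (insertions (2 + n)) (setPartitions (1 + n))) weight
    ≈⟨ sumOver-concatMap (setPartitions (1 + n)) (insertions (2 + n)) weight ⟩
  (∑[ ρ ∈ setPartitions (1 + n) ] sumOver (insertions (2 + n) ρ) weight)
    ≈⟨ sumOver-cong (All.map split (setPartitions-partitionOf (1 + n))) ⟩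
  (∑[ ρ ∈ setPartitions (1 + n) ] (q^ (1 + n) ⊗ weight ρ ⊕ f ρ))
    ≈⟨ sumOver-⊕ (setPartitions (1 + n)) _ f ⟩
  (∑[ ρ ∈ setPartitions (1 + n) ] (q^ (1 + n) ⊗ weight ρ)) ⊕ sumOver (setPartitions (1 + n)) f
    -- The first sum has n + 2 alone in its block. In the second the last block has size two, so the
    -- insertion of n + 1 is unfolded as well, down to partitions of [n].
    ≈⟨ ⊕-cong (∑weight (1 + n)) (begin
      sumOver (setPartitions (1 + n)) f
        ≈⟨ sumOver-concatMap (setPartitions n) (insertions (1 + n)) f ⟩
      (∑[ π ∈ setPartitions n ] sumOver (insertions (1 + n) π) f)
        ≈⟨ sumOver-cong (All.map ∑insertions-∑extensions (setPartitions-partitionOf n)) ⟩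
      (∑[ π ∈ setPartitions n ] (q^ n ⊗ weight π))
        ≈⟨ ∑weight n ⟩
      q^ n ⊗ F n ∎) ⟩
  q^ (1 + n) ⊗ F (1 + n) ⊕ q^ n ⊗ F n ∎
  where
  f : Partition → Poly
  f ρ = sumOver (extensions (2 + n) ρ) weight
  ∑weight : ∀ m → (∑[ π ∈ setPartitions m ] (q^ m ⊗ weight π)) ≃ q^ m ⊗ F m
  ∑weight m = ≃-trans (sumOver-⊗ˡ (setPartitions m) (q^ m) weight)
                      (⊗-congˡ (q^ m) (≃-sym (F≃∑weight m)))
  split : ∀ {ρ} → PartitionOf (1 + n) ρ →
    sumOver (insertions (2 + n) ρ) weight ≃ q^ (1 + n) ⊗ weight ρ ⊕ f ρ
  split {ρ} part rewrite insertions≡extensions∷ʳ (2 + n) ρ = begin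
    sumOver (extensions (2 + n) ρ ∷ʳ (ρ ∷ʳ [ 2 + n ])) weight
      ≈⟨ sumOver-∷ʳ (extensions (2 + n) ρ) _ weight ⟩
    f ρ ⊕ weight (ρ ∷ʳ [ 2 + n ])
      ≈⟨ ⊕-comm (f ρ) _ ⟩
    weight (ρ ∷ʳ [ 2 + n ]) ⊕ f ρ
      ≈⟨ ⊕-cong (weight-append (([-] , inj₁ refl) ∷ []) part) ≃-refl ⟩
    q^ (1 + n) ⊗ weight ρ ⊕ f ρ ∎

-- The product identity

∏1+q^ : ℕ → ℕ → Poly
∏1+q^ a n = ∏[ i ∈ range a n ] (1ₚ ⊕ q^ i)

∏1+q^-suc : ∀ {a n} → a ≤ suc n → ∏1+q^ a (suc n) ≃ ∏1+q^ a n ⊗ (1ₚ ⊕ q^ suc n)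
∏1+q^-suc {a} {n} a≤1+n rewrite range-∷ʳ a≤1+n = prodOver-∷ʳ (range a n) (suc n) (λ i → 1ₚ ⊕ q^ i)

∏1+q^-empty : ∀ {a n} → n < a → ∏1+q^ a n ≃ 1ₚ
∏1+q^-empty n<a rewrite range-empty n<a = ≃-refl

-- Truncated subtraction makes the sum empty for both n = 0 and n = 1.
correction : ℕ → Poly
correction n = ∑[ k ∈ upTo (n ∸ 1) ] (q^ k ⊗ F k ⊗ ∏1+q^ (k + 3) n)

-- Every old summand gains the factor 1 + q^(n + 2). The new summand k = n carries an empty product,
-- since its range would start at n + 3.
correction-suc : ∀ n → correction (2 + n) ≃ correction (1 + n) ⊗ (1ₚ ⊕ q^ (2 + n)) ⊕ q^ n ⊗ F n
correction-suc n = begin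
  sumOver (upTo (suc n)) (term (2 + n))
    ≡⟨ cong (λ ks → sumOver ks (term (2 + n))) (applyUpTo-∷ʳ (λ k → k) n) ⟨
  sumOver (upTo n ∷ʳ n) (term (2 + n))
    ≈⟨ sumOver-∷ʳ (upTo n) n (term (2 + n)) ⟩
  sumOver (upTo n) (term (2 + n)) ⊕ term (2 + n) n
    ≈⟨ ⊕-cong (sumOver-cong (All.map factor (all-upTo n))) last ⟩
  (∑[ k ∈ upTo n ] (term (1 + n) k ⊗ (1ₚ ⊕ q^ (2 + n)))) ⊕ q^ n ⊗ F n
    ≈⟨ ⊕-cong (sumOver-⊗ʳ (upTo n) (term (1 + n)) _) ≃-refl ⟩
  correction (1 + n) ⊗ (1ₚ ⊕ q^ (2 + n)) ⊕ q^ n ⊗ F n ∎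
  where
  term : ℕ → ℕ → Poly
  term m k = q^ k ⊗ F k ⊗ ∏1+q^ (k + 3) m
  factor : ∀ {k} → k < n → term (2 + n) k ≃ term (1 + n) k ⊗ (1ₚ ⊕ q^ (2 + n))
  factor {k} k<n = ≃-trans
    -- From k < n comes k + 3 ≤ n + 2. Equality is the boundary case in which an empty product
    -- acquires its first factor.
    (⊗-congˡ (q^ k ⊗ F k) (∏1+q^-suc (subst (_≤ 2 + n) (+-comm 3 k) (s≤s (s≤s k<n)))))
    (≃-sym (⊗-assoc (q^ k ⊗ F k) _ _))
  last : term (2 + n) n ≃ q^ n ⊗ F n
  last = ≃-trans (⊗-congˡ (q^ n ⊗ F n) (∏1+q^-empty (≤-reflexive (+-comm 3 n)))) (⊗-identityʳ _)

∏≃F⊕correction : ∀ n → ∏1+q^ 1 n ≃ F (suc n) ⊕ correction n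
∏≃F⊕correction zero          = ≃-refl
∏≃F⊕correction (suc zero)    = ≃-refl
∏≃F⊕correction (suc (suc n)) = begin
  ∏1+q^ 1 (2 + n)
    ≈⟨ ∏1+q^-suc {1} {1 + n} (s≤s z≤n) ⟩
  ∏1+q^ 1 (1 + n) ⊗ (1ₚ ⊕ Q)
    ≈⟨ ⊗-cong (∏≃F⊕correction (suc n)) ≃-refl ⟩
  (F (2 + n) ⊕ T) ⊗ (1ₚ ⊕ Q)
    ≈⟨ solve 3 (λ f t q → (f :+ t) :* (con 1 :+ q) := q :* f :+ f :+ t :* (con 1 :+ q)) ≃-refl (F (2 + n)) T Q ⟩
  Q ⊗ F (2 + n) ⊕ F (2 + n) ⊕ T ⊗ (1ₚ ⊕ Q)
    -- Only the copy of `F (2 + n)` without the factor `Q` is unfolded. Its part `x` combines with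
    -- `Q ⊗ F (2 + n)` into `F (3 + n)` by the next instance of the recurrence, and `y` is the
    -- summand that `correction-suc` adds.
    ≈⟨ ⊕-cong (⊕-cong (≃-refl {Q ⊗ F (2 + n)}) (F-recurrence n)) (≃-refl {T ⊗ (1ₚ ⊕ Q)}) ⟩
  Q ⊗ F (2 + n) ⊕ (x ⊕ y) ⊕ T ⊗ (1ₚ ⊕ Q)
    ≈⟨ solve 4 (λ z x y t → z :+ (x :+ y) :+ t := (z :+ x) :+ (t :+ y)) ≃-refl (Q ⊗ F (2 + n)) x y (T ⊗ (1ₚ ⊕ Q)) ⟩
  (Q ⊗ F (2 + n) ⊕ x) ⊕ (T ⊗ (1ₚ ⊕ Q) ⊕ y)
    ≈⟨ ⊕-cong (F-recurrence (1 + n)) (correction-suc n) ⟨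
  F (3 + n) ⊕ correction (2 + n) ∎
  where
  Q T x y : Poly
  Q = q^ (2 + n)
  T = correction (1 + n)
  x = q^ (1 + n) ⊗ F (1 + n)
  y = q^ n ⊗ F n

theorem4p8 : ∀ (n : ℕ) → (∏[ i ∈ range 1 n ] (1ₚ ⊕ q^ i)) ≈ F (n + 1) ⊕ (∑[ k ∈ upTo (n ∸ 1) ] (q^ k ⊗ F k ⊗ (∏[ i ∈ range (k + 3) n ] (1ₚ ⊕ q^ i))))
theorem4p8 n rewrite +-comm n 1 = at (∏≃F⊕correction n)
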